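{- Let $\mathcal{L}\subseteq\mathbb{Z}^3$ be an order ideal with $\mathcal{L}\subseteq C(0,0,0)$ and $\mathcal{U}\cap C(0,0,0)$ finite, let $\mathcal{I}$ be as in the context, and let $N$ be a cutoff for $\mathcal{I}$. Then every $\mathcal{I}$-grove within radius $N$ is acyclic.
   Context: For $(i,j,k)\in\mathbb{Z}^3$ let $C(i,j,k)=\{(i',j',k') : i'\le i,\ j'\le j,\ k'\le k\}$. $\mathcal{L}\subseteq\mathbb{Z}^3$ satisfies: $(i,j,k)\in\mathcal{L}\Rightarrow C(i,j,k)\subseteq\mathcal{L}$. $\mathcal{U}=\mathbb{Z}^3\setminus\mathcal{L}$, $\mathcal{I}=\{(i,j,k)\in\mathcal{L} : (i+1,j+1,k+1)\in\mathcal{U}\}$. A cutoff for $\mathcal{I}$ is an integer $N$ such that (i) $(i,j,k)\in\mathcal{I}$ whenever $i+j+k\le -N$ and $\max\{i,j,k\}=0$; (ii) $(i,j,k)\notin\mathcal{I}$ whenever $i+j+k\le -N-3$ and $\max\{i,j,k\}<0$. For $(i,j,k)\in\mathcal{I}$ let $r_a(i,j,k)=\{(i,j,k),(i,j-1,k),(i,j,k-1),(i,j-1,k-1)\}$, $r_b(i,j,k)=\{(i,j,k),(i-1,j,k),(i,j,k-1),(i-1,j,k-1)\}$, $r_c(i,j,k)=\{(i,j,k),(i-1,j,k),(i,j-1,k),(i-1,j-1,k)\}$; a rhombus is such a set contained in $\mathcal{I}$. Long edges: $e_a(i,j,k)=\{(i,j-1,k),(i,j,k-1)\}$, $e_b(i,j,k)=\{(i-1,j,k),(i,j,k-1)\}$,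 $e_c(i,j,k)=\{(i-1,j,k),(i,j-1,k)\}$; short edges: $e'_a(i,j,k)=\{(i,j,k),(i,j-1,k-1)\}$, $e'_b(i,j,k)=\{(i,j,k),(i-1,j,k-1)\}$, $e'_c(i,j,k)=\{(i,j,k),(i-1,j-1,k)\}$ (for the rhombus $r_a,r_b,r_c$ respectively). $\mathcal{G}$ is the graph on $\mathcal{I}$ whose edges are the long and short edges of all rhombi. An $\mathcal{I}$-grove within radius $N$ is a subgraph $G\subseteq\mathcal{G}$ with: vertex set all of $\mathcal{I}$; for every rhombus exactly one of its two edges in $G$; for every rhombus all of whose vertices satisfy $i+j+k<-N$, its short edge in $G$; and every component of $G$ contains exactly one of the following sets, each of which lies in some component: $\{(0,p,q),(p,0,q)\}$, $\{(p,q,0),(0,q,p)\}$, $\{(q,0,p),(q,p,0)\}$ for $0>p>q$, $p+q\in\{ -N-1,-N-2\}$; $\{(0,p,p),(p,0,p),(p,p,0)\}$ for $2p\in\{ -N-1,-N-2\}$; $\{(0,0,q)\},\{(0,q,0)\},\{(q,0,0)\}$ for $q\le -N-1$. -}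

module Defs where

open import Level using (0ℓ)
open import Data.Integer using (ℤ; _+_; _-_; -_; _≤_; _<_; _⊔_; +_; 0ℤ; 1ℤ)
open import Data.Nat using (ℕ)
import Data.Nat as ℕ
open import Data.Product using (Σ; ∃; ∃-syntax; _×_; _,_)
open import Data.Sum using (_⊎_)
open import Data.List using (List; []; _∷_; _++_; [_]; length)
open import Data.List.Relation.Unary.All using (All)
open import Data.List.Relation.Unary.Linked using (Linked)
open import Data.List.Relation.Unary.Unique.Propositional using (Unique)
open import Data.List.Membership.Propositional using (_∈_)
open import Relation.Binary.PropositionalEquality using (_≡_)
open import Relation.Binary.Construct.Closure.ReflexiveTransitive using (Star)
open import Relation.Nullary using (¬_)
open import Function.Bundles using (_⇔_)

Pt : Set
Pt = ℤ × ℤ × ℤ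

-- coordinatewise order: (i',j',k') ∈ C(i,j,k)  iff  (i',j',k') ≤³ (i,j,k)
_≤³_ : Pt → Pt → Set
(i' , j' , k') ≤³ (i , j , k) = (i' ≤ i) × (j' ≤ j) × (k' ≤ k)

origin : Pt
origin = (0ℤ , 0ℤ , 0ℤ)

coordSum : Pt → ℤ
coordSum (i , j , k) = i + j + k

coordMax : Pt → ℤ
coordMax (i , j , k) = i ⊔ j ⊔ k

Subset : Set₁
Subset = Pt → Set

IsOrderIdeal : Subset → Set
IsOrderIdeal L = ∀ p q → q ≤³ p → L p → L q

InOriginCone : Subset → Set
InOriginCone L = ∀ p → L p → p ≤³ origin

UCapConeFinite : Subset → Set
UCapConeFinite L = ∃[ xs ] (∀ p → p ≤³ origin → ¬ L p → p ∈ xs)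

𝓘 : Subset → Subset
𝓘 L (i , j , k) = L (i , j , k) × ¬ L (i + 1ℤ , j + 1ℤ , k + 1ℤ)

IsCutoff : Subset → ℤ → Set
IsCutoff I N =
  (∀ p → coordSum p ≤ - N → coordMax p ≡ 0ℤ → I p) ×
  (∀ p → coordSum p ≤ - N - + 3 → coordMax p < 0ℤ → ¬ I p)

data RType : Set where
  ta tb tc : RType

rhombusVerts : RType → Pt → List Pt
rhombusVerts ta (i , j , k) = (i , j , k) ∷ (i , j - 1ℤ , k) ∷ (i , j , k - 1ℤ) ∷ (i , j - 1ℤ , k - 1ℤ) ∷ []
rhombusVerts tb (i , j , k) = (i , j , k) ∷ (i - 1ℤ , j , k) ∷ (i , j , k - 1ℤ) ∷ (i - 1ℤ , j , k - 1ℤ) ∷ []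
rhombusVerts tc (i , j , k) = (i , j , k) ∷ (i - 1ℤ , j , k) ∷ (i , j - 1ℤ , k) ∷ (i - 1ℤ , j - 1ℤ , k) ∷ []

longEdge : RType → Pt → Pt × Pt
longEdge ta (i , j , k) = ((i , j - 1ℤ , k) , (i , j , k - 1ℤ))
longEdge tb (i , j , k) = ((i - 1ℤ , j , k) , (i , j , k - 1ℤ))
longEdge tc (i , j , k) = ((i - 1ℤ , j , k) , (i , j - 1ℤ , k))

shortEdge : RType → Pt → Pt × Pt
shortEdge ta (i , j , k) = ((i , j , k) , (i , j - 1ℤ , k - 1ℤ))
shortEdge tb (i , j , k) = ((i , j , k) , (i - 1ℤ , j , k - 1ℤ))
shortEdge tc (i , j , k) = ((i , j , k) , (i - 1ℤ , j - 1ℤ , k))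

IsRhombus : Subset → RType → Pt → Set
IsRhombus I t p = All I (rhombusVerts t p)

Graph : Set₁
Graph = Pt → Pt → Set

HasEdge : Graph → Pt × Pt → Set
HasEdge G (a , b) = G a b

SameEdge : Pt × Pt → Pt → Pt → Set
SameEdge (a , b) u v = (u ≡ a × v ≡ b) ⊎ (u ≡ b × v ≡ a)

𝒢Edge : Subset → Pt → Pt → Set
𝒢Edge I u v = ∃[ t ] ∃[ p ] (IsRhombus I t p ×
                 (SameEdge (longEdge t p) u v ⊎ SameEdge (shortEdge t p) u v))

data Label : Set where
  pairA pairB pairC : ℤ → ℤ → Label
  triple : ℤ → Label
  singleA singleB singleC : ℤ → Label

labelSet : Label → List Pt
labelSet (pairA p q) = (0ℤ , p , q) ∷ (p , 0ℤ , q) ∷ []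
labelSet (pairB p q) = (p , q , 0ℤ) ∷ (0ℤ , q , p) ∷ []
labelSet (pairC p q) = (q , 0ℤ , p) ∷ (q , p , 0ℤ) ∷ []
labelSet (triple p)  = (0ℤ , p , p) ∷ (p , 0ℤ , p) ∷ (p , p , 0ℤ) ∷ []
labelSet (singleA q) = (0ℤ , 0ℤ , q) ∷ []
labelSet (singleB q) = (0ℤ , q , 0ℤ) ∷ []
labelSet (singleC q) = (q , 0ℤ , 0ℤ) ∷ []

InRange : ℤ → ℤ → Set
InRange N x = (x ≡ - N - 1ℤ) ⊎ (x ≡ - N - + 2)

PairCond : ℤ → ℤ → ℤ → Set
PairCond N p q = (p < 0ℤ) × (q < p) × InRange N (p + q)

ValidLabel : ℤ → Label → Set
ValidLabel N (pairA p q) = PairCond N p q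
ValidLabel N (pairB p q) = PairCond N p q
ValidLabel N (pairC p q) = PairCond N p q
ValidLabel N (triple p)  = InRange N (p + p)
ValidLabel N (singleA q) = q ≤ - N - 1ℤ
ValidLabel N (singleB q) = q ≤ - N - 1ℤ
ValidLabel N (singleC q) = q ≤ - N - 1ℤ

SameSet : List Pt → List Pt → Set
SameSet S T = ∀ x → (x ∈ S) ⇔ (x ∈ T)

Connected : Graph → Pt → Pt → Set
Connected G = Star G

ComponentContains : Graph → Pt → List Pt → Set
ComponentContains G v S = All (Connected G v) S

record IsGrove (I : Subset) (N : ℤ) (G : Graph) : Set₁ where
  field
    symmetric   : ∀ u v → G u v → G v u
    subgraph    : ∀ u v → G u v → 𝒢Edge I u v
    oneEdge     : ∀ t p → IsRhombus I t p →
                    HasEdge G (longEdge t p) ⊎ HasEdge G (shortEdge t p)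
    notBoth     : ∀ t p → IsRhombus I t p →
                    ¬ (HasEdge G (longEdge t p) × HasEdge G (shortEdge t p))
    farShort    : ∀ t p → IsRhombus I t p →
                    All (λ x → coordSum x < - N) (rhombusVerts t p) →
                    HasEdge G (shortEdge t p)
    setsInComp  : ∀ ℓ → ValidLabel N ℓ →
                    ∃[ v ] (I v × ComponentContains G v (labelSet ℓ))
    compHasSet  : ∀ v → I v →
                    ∃[ ℓ ] (ValidLabel N ℓ × ComponentContains G v (labelSet ℓ))
    compUnique  : ∀ v → I v → ∀ ℓ ℓ' → ValidLabel N ℓ → ValidLabel N ℓ' →
                    ComponentContains G v (labelSet ℓ) →
                    ComponentContains G v (labelSet ℓ') →
                    SameSet (labelSet ℓ) (labelSet ℓ')

HasCycle : Graph → Set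
HasCycle G = ∃[ v ] ∃[ vs ]
  (3 ℕ.≤ length (v ∷ vs) × Unique (v ∷ vs) × Linked G ((v ∷ vs) ++ [ v ]))

Acyclic : Graph → Set
Acyclic G = ¬ HasCycle G

{-# OPTIONS --safe #-}
-- A mod 2 Jordan curve argument. The two diagonals of a rhombus join vertices of opposite parity of i + j + k,
-- so a cycle of G lives on one parity class. For a vertex u of the other class, count mod 2 the edges of the cycle
-- met by a ray from u on the surface. This flux differs at the ends of a rhombus diagonal exactly when the cycle
-- uses the other diagonal; hence it is constant on the components of G of that class. Each of these components
-- contains an infinite path along which i tends to -∞, so that the flux is eventually 0 on it. But the flux must
-- differ at the two ends of the diagonal crossing an edge of the cycle.
module Submission where

open import Defs
open import Algebra.Bundles using (CommutativeMonoid; CommutativeRing)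
open import Data.Bool using (Bool; true; false; not; _∧_; _xor_)
open import Data.Bool.Properties using (xor-same; xor-comm; xor-assoc; xor-identityʳ; ∧-zeroʳ; ∧-idem; ∧-comm; not-involutive; not-distribʳ-xor; xor-∧-commutativeRing)
open import Algebra.Properties.CommutativeSemigroup
  (CommutativeMonoid.commutativeSemigroup (CommutativeRing.+-commutativeMonoid xor-∧-commutativeRing))
  using (interchange)
open import Data.Empty using (⊥; ⊥-elim)
open import Data.Integer using (ℤ; +_; -[1+_]; _+_; _-_; -_; _≤_; _<_; 0ℤ; 1ℤ; _≤?_; _⊓_; _⊔_; ∣_∣; +<+; -≤-; -<-; -<+)
import Data.Integer.Properties as ℤ
open import Data.Integer.Tactic.RingSolver using (solve-∀)
open import Data.List using ([]; _∷_; _++_; [_])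
open import Data.List.Relation.Unary.All as All using (All; []; _∷_)
open import Data.List.Relation.Unary.AllPairs using (_∷_)
open import Data.List.Relation.Unary.Linked using (Linked; []; [-]; _∷_)
open import Data.Nat using (ℕ; zero; suc)
import Data.Nat as ℕ
import Data.Nat.Properties as ℕ
open import Data.Product using (∃-syntax; _×_; _,_; proj₁; proj₂)
open import Data.Sum using (_⊎_; inj₁; inj₂; [_,_]′)
open import Function using (_∘_)
open import Relation.Binary.Construct.Closure.ReflexiveTransitive using (Star; ε; _◅_; _◅◅_)
open import Relation.Nullary using (¬_; yes; no)
open import Relation.Binary.PropositionalEquality hiding ([_])

-- Boolean tests on integers

isZero pos : ℤ → Bool
isZero (+ zero) = true
isZero (+ suc _) = false
isZero -[1+ _ ] = false
pos (+ zero) = false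
pos (+ suc _) = true
pos -[1+ _ ] = false

-- Both tests depend on a difference only, so ring identities rewrite their arguments and moving a
-- threshold becomes a shift of one integer.
_==_ _<ᵇ_ : ℤ → ℤ → Bool
x == y = isZero (x - y)
x <ᵇ y = pos (y - x)

infix 5 _==_ _<ᵇ_

oddℕ : ℕ → Bool
oddℕ zero = false
oddℕ (suc n) = not (oddℕ n)

odd : ℤ → Bool
odd (+ n) = oddℕ n
odd -[1+ n ] = not (oddℕ n)

odd-1+ : ∀ z → odd (1ℤ + z) ≡ not (odd z)
odd-1+ (+ n) = refl
odd-1+ -[1+ zero ] = refl
odd-1+ -[1+ suc n ] = sym (not-involutive _)

isZero-sound : ∀ z → isZero z ≡ true → z ≡ 0ℤ
isZero-sound (+ zero) _ = refl

pos-sound : ∀ z → pos z ≡ true → 0ℤ < z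
pos-sound (+ suc n) _ = +<+ ℕ.z<s

pos-complete : ∀ z → 0ℤ < z → pos z ≡ true
pos-complete (+ suc n) _ = refl
pos-complete (+ zero) (+<+ ())

==-sound : ∀ x y → (x == y) ≡ true → x ≡ y
==-sound x y q = ℤ.i-j≡0⇒i≡j x y (isZero-sound _ q)

==-refl : ∀ x → (x == x) ≡ true
==-refl x = cong isZero (ℤ.+-inverseʳ x)

≤⇒<ᵇ : ∀ {x y} → x ≤ y → (x <ᵇ 1ℤ + y) ≡ true
≤⇒<ᵇ {x} {y} x≤y = pos-complete _ (ℤ.suc[i]≤j⇒i<j
  (subst (1ℤ + 0ℤ ≤_) (shift x y) (ℤ.+-monoʳ-≤ 1ℤ (ℤ.i≤j⇒0≤j-i x≤y))))
  where
  shift : ∀ x y → 1ℤ + (y - x) ≡ 1ℤ + y - x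
  shift = solve-∀

<⇒<ᵇ : ∀ {x y} → x < y → (x <ᵇ y) ≡ true
<⇒<ᵇ {x} {y} x<y = trans (cong pos (shift x y)) (≤⇒<ᵇ (ℤ.i<j⇒suc[i]≤j x<y))
  where
  shift : ∀ x y → y - x ≡ 1ℤ + y - (1ℤ + x)
  shift = solve-∀

<ᵇ-sound : ∀ x y → (x <ᵇ y) ≡ true → x < y
<ᵇ-sound x y q = subst₂ _<_ (ℤ.+-identityˡ x) (shift x y) (ℤ.+-monoˡ-< x (pos-sound _ q))
  where
  shift : ∀ x y → y - x + x ≡ y
  shift = solve-∀

pos-step : ∀ z → pos (1ℤ + z) xor pos z ≡ isZero z
pos-step (+ zero) = refl
pos-step (+ suc n) = refl
pos-step -[1+ zero ] = refl
pos-step -[1+ suc n ] = refl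

-- A threshold moved by two changes the test at two integers, `0ℤ` and `1ℤ`. In `incidence` a parity
-- argument excludes `1ℤ`.
pos-step₂ : ∀ z → z ≢ 1ℤ → pos (1ℤ + z) xor pos (z - 1ℤ) ≡ isZero z
pos-step₂ (+ zero) _ = refl
pos-step₂ (+ suc zero) z≢1 = ⊥-elim (z≢1 refl)
pos-step₂ (+ suc (suc n)) _ = refl
pos-step₂ -[1+ zero ] _ = refl
pos-step₂ -[1+ suc n ] _ = refl

guard-xor : ∀ g {a b} → a ≡ b → (g ∧ a) xor (g ∧ b) ≡ false
guard-xor g {a} refl = xor-same (g ∧ a)

isZero-clash : ∀ z → isZero (z - 1ℤ) ∧ isZero (1ℤ + z) ≡ false
isZero-clash (+ zero) = refl
isZero-clash (+ suc n) = ∧-zeroʳ _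
isZero-clash -[1+ n ] = refl

-- Diagonals, rays and swept regions

-- lvl + col has the parity of i + j + k, so all points with a given lvl and col have the same parity; jco tells them apart.
lvl jco col : Pt → ℤ
lvl (i , j , k) = i
jco (i , j , k) = j
col (i , j , k) = j - k

down : Pt → Pt
down (i , j , k) = (i - 1ℤ , j , k)

-- short p and long p are the diagonals of r_a(p); wall t b is the diagonal from t to b - (1,0,0) of an r_b or r_c,
-- where t and b are the ends of the side of that rhombus on the higher level.
data Diag : Set where
  short long : Pt → Diag
  wall : Pt → Pt → Diag

ends : Diag → Pt × Pt
ends (short p) = shortEdge ta p
ends (long p) = longEdge ta p
ends (wall t b) = (t , down b)

dual : Diag → Diag
dual (short p) = long p
dual (long p) = short p
dual (wall t b) = wall b t

-- Congruent mod 2 to lvl + col at both ends.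
ρ : Diag → ℤ
ρ (short p) = lvl p + col p
ρ (long p) = lvl p + (1ℤ + col p)
ρ (wall t b) = lvl t + col t

Adjacent : Pt → Pt → Set
Adjacent t b = (col b ≡ 1ℤ + col t) ⊎ (col t ≡ 1ℤ + col b)

-- The ray from u first goes towards larger i inside its level, across the long diagonals of column col u, up to
-- the strip of rhombi r_b, r_c between the levels lvl u and lvl u + 1, and then follows that strip towards
-- increasing col.
χ : Pt → Diag → Bool
χ u (short p) = false
χ u (long p) = (lvl p == lvl u) ∧ ((col p == col u) ∧ (jco p <ᵇ 1ℤ + jco u))
χ u (wall t b) = (lvl (down b) == lvl u) ∧ (col u <ᵇ col b)

-- Moving the ray from one end of c to the other sweeps over the vertices v with h c v = true.
h : Diag → Pt → Bool
h (short p) v = false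
h (long p) v = (lvl v == lvl p) ∧ ((col v == col p) ∧ (jco v <ᵇ jco p))
h (wall t b) v = (lvl v == lvl t) ∧ (col t <ᵇ col v)

-- For walls only the level and the two columns are compared, since `χ` and `h` read nothing else
-- from a wall. On valid walls these data determine both points, by `wall-unique`.
δ : Diag → Diag → Bool
δ (short q) (short p) = (lvl q == lvl p) ∧ ((col q == col p) ∧ (jco p == jco q))
δ (long q) (long p) = (lvl q == lvl p) ∧ ((col q == col p) ∧ (jco p == jco q))
δ (wall t' b') (wall t b) = (lvl t' == lvl t) ∧ ((col t' == col t) ∧ (col b' == col b))
δ _ _ = false

-- Boolean identities and parity

∧-xor₂ : ∀ g a {b c d} → b xor c ≡ d → (g ∧ (a ∧ b)) xor (g ∧ (a ∧ c)) ≡ g ∧ (a ∧ d)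
∧-xor₂ false a q = refl
∧-xor₂ true false q = refl
∧-xor₂ true true q = q

∧₃-false : ∀ a b {c} → (a ≡ true → b ≡ true → c ≡ true → ⊥) → a ∧ (b ∧ c) ≡ false
∧₃-false false _ _ = refl
∧₃-false true false _ = refl
∧₃-false true true {false} _ = refl
∧₃-false true true {true} ¬abc = ⊥-elim (¬abc refl refl refl)

∧₃-absorb : ∀ a b {c} → (a ≡ true → b ≡ true → c ≡ true) → a ∧ (b ∧ c) ≡ a ∧ b
∧₃-absorb false _ _ = refl
∧₃-absorb true false _ = refl
∧₃-absorb true true p = p refl refl

xor-inner : ∀ a b → (a xor b) xor (b xor a) ≡ false
xor-inner a b = trans (cong ((a xor b) xor_) (xor-comm b a)) (xor-same (a xor b))

-- The hypothesis is asked only when `g` is true: `g` will be an equality of levels, and the parity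
-- argument for the columns starts from that equality.
wall-row : ∀ g a b c → (g ≡ true → a xor b ≡ c) → ((g ∧ a) xor (g ∧ b)) xor (g ∧ c) ≡ false
wall-row false _ _ _ _ = refl
wall-row true a b c p = trans (cong (_xor c) (p refl)) (xor-same c)

pair-row : ∀ g a b {d} → (g ≡ true → a xor b ≡ d) → (g ∧ a) xor (g ∧ b) ≡ g ∧ d
pair-row false _ _ _ = refl
pair-row true _ _ p = p refl

¬odd : ∀ {d} → odd d ≡ true → ∀ e → d ≡ e → odd e ≡ false → ⊥
¬odd p e refl q with trans (sym p) q
... | ()

odd-+ : ∀ x y → odd (x + y) ≡ odd x xor odd y
odd-+ x (+ zero) = trans (cong odd (ℤ.+-identityʳ x)) (sym (xor-identityʳ _))
odd-+ x (+ suc n) = begin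
  odd (x + + suc n)         ≡⟨ cong odd (shift x (+ n)) ⟩
  odd (1ℤ + (x + + n))      ≡⟨ odd-1+ (x + + n) ⟩
  not (odd (x + + n))       ≡⟨ cong not (odd-+ x (+ n)) ⟩
  not (odd x xor oddℕ n)    ≡⟨ not-distribʳ-xor (odd x) (oddℕ n) ⟩
  odd x xor not (oddℕ n)    ∎
  where
  open ≡-Reasoning
  shift : ∀ x y → x + (1ℤ + y) ≡ 1ℤ + (x + y)
  shift = solve-∀
odd-+ x -[1+ n ] = begin
  odd (x + -[1+ n ])                   ≡⟨ not-involutive _ ⟨
  not (not (odd (x + -[1+ n ])))       ≡⟨ cong not (odd-1+ (x + -[1+ n ])) ⟨
  not (odd (1ℤ + (x + -[1+ n ])))      ≡⟨ cong (not ∘ odd) (shift x -[1+ n ]) ⟩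
  not (odd (x + (1ℤ + -[1+ n ])))      ≡⟨ cong not (previous n) ⟩
  not (odd x xor odd (1ℤ + -[1+ n ]))  ≡⟨ not-distribʳ-xor (odd x) _ ⟩
  odd x xor not (odd (1ℤ + -[1+ n ]))  ≡⟨ cong (λ b → odd x xor not b) (odd-1+ -[1+ n ]) ⟩
  odd x xor not (not (odd -[1+ n ]))   ≡⟨ cong (odd x xor_) (not-involutive _) ⟩
  odd x xor odd -[1+ n ]               ∎
  where
  open ≡-Reasoning
  shift : ∀ x y → 1ℤ + (x + y) ≡ x + (1ℤ + y)
  shift = solve-∀
  -- Splitting on `n` makes `1ℤ + -[1+ n ]` compute to an integer one step nearer to zero, where
  -- `odd-+` can be called again.
  previous : ∀ n → odd (x + (1ℤ + -[1+ n ])) ≡ odd x xor odd (1ℤ + -[1+ n ])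
  previous zero = odd-+ x 0ℤ
  previous (suc n) = odd-+ x -[1+ n ]

odd-neg : ∀ x → odd (- x) ≡ odd x
odd-neg (+ zero) = refl
odd-neg (+ suc n) = refl
odd-neg -[1+ n ] = refl

opposite⇒odd-difference : ∀ x y → odd x ≡ not (odd y) → odd (x - y) ≡ true
opposite⇒odd-difference x y q =
  trans (odd-+ x (- y)) (trans (cong₂ _xor_ q (odd-neg y)) (not-xor (odd y)))
  where
  not-xor : ∀ b → not b xor b ≡ true
  not-xor false = refl
  not-xor true = refl

parity : Pt → Bool
parity v = odd (lvl v + col v)

odd-+2 : ∀ z → odd (1ℤ + (1ℤ + z)) ≡ odd z
odd-+2 z = trans (odd-1+ (1ℤ + z)) (trans (cong not (odd-1+ z)) (not-involutive _))

sub-add : ∀ x → x - 1ℤ + 1ℤ ≡ x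
sub-add = solve-∀

col-third : ∀ j k → j - (k - 1ℤ) ≡ 1ℤ + (j - k)
col-third = solve-∀

col-second : ∀ j k → j - k ≡ 1ℤ + ((j - 1ℤ) - k)
col-second = solve-∀

SameEdge-swap : ∀ {a b u v} → SameEdge (a , b) u v → SameEdge (b , a) u v
SameEdge-swap (inj₁ s) = inj₂ s
SameEdge-swap (inj₂ s) = inj₁ s

SameEdge-sym : ∀ {d u v} → SameEdge d u v → SameEdge d v u
SameEdge-sym (inj₁ (p , q)) = inj₂ (q , p)
SameEdge-sym (inj₂ (p , q)) = inj₁ (q , p)

SameEdge-all : ∀ {d u v} (P : Pt → Set) → SameEdge d u v → P (proj₁ d) × P (proj₂ d) → P u × P v
SameEdge-all P (inj₁ (refl , refl)) (p , q) = p , q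
SameEdge-all P (inj₂ (refl , refl)) (p , q) = q , p

SameEdge-xor : ∀ (φ : Pt → Bool) {d u v} → SameEdge d u v → φ (proj₁ d) xor φ (proj₂ d) ≡ φ u xor φ v
SameEdge-xor φ (inj₁ (refl , refl)) = refl
SameEdge-xor φ {a , b} (inj₂ (refl , refl)) = xor-comm (φ a) (φ b)

xor-chain : ∀ a b c → (a xor b) xor (b xor c) ≡ a xor c
xor-chain a b c = trans (xor-assoc a b (b xor c))
  (cong (a xor_) (trans (sym (xor-assoc b b c)) (cong (_xor c) (xor-same b))))

∧-true : ∀ a b → a ∧ b ≡ true → a ≡ true × b ≡ true
∧-true true true _ = refl , refl

xor-false⇒≡ : ∀ a b → a xor b ≡ false → a ≡ b
xor-false⇒≡ false b q = sym q
xor-false⇒≡ true true _ = refl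

endpoints : ∀ {d u v x y} → SameEdge d u v → SameEdge d x y → x ≡ u ⊎ x ≡ v
endpoints (inj₁ (refl , refl)) (inj₁ (refl , refl)) = inj₁ refl
endpoints (inj₁ (refl , refl)) (inj₂ (refl , refl)) = inj₂ refl
endpoints (inj₂ (refl , refl)) (inj₁ (refl , refl)) = inj₂ refl
endpoints (inj₂ (refl , refl)) (inj₂ (refl , refl)) = inj₁ refl

-- Local geometry of the surface and the crossing identity

module Surface (L : Subset) (ideal : IsOrderIdeal L) where

  -- `Face p` means that r_a(p) is a rhombus of the surface. `Wall p` means that p is the last point
  -- of `L` in its level and column, as happens when p and `down p` both lie on the surface.
  Face Wall : Pt → Set
  Face (i , j , k) = L (i , j , k) × ¬ L (i + 1ℤ , j , k)
  Wall (i , j , k) = L (i , j , k) × ¬ L (i , j + 1ℤ , k + 1ℤ)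

  Valid : Diag → Set
  Valid (short p) = Face p
  Valid (long p) = Face p
  Valid (wall t b) = Wall t × Wall b × lvl t ≡ lvl b × Adjacent t b

  third-≤ : ∀ {j k j' k'} → j - k ≡ j' - k' → j ≤ j' → k ≤ k'
  third-≤ {j} {k} {j'} {k'} q j≤j' = subst₂ _≤_ (cancel j k) (trans (cong (λ d → j' - d) q) (cancel j' k'))
    (ℤ.+-monoˡ-≤ (- (j - k)) j≤j')
    where
    cancel : ∀ j k → j - (j - k) ≡ k
    cancel = solve-∀

  -- Points of equal level and column differ by a multiple of (0,1,1), so comparing `jco` is enough
  -- to apply `ideal`.
  L-along-column : ∀ {i j k j' k'} → j - k ≡ j' - k' → j ≤ j' → L (i , j' , k') → L (i , j , k)
  L-along-column q j≤j' = ideal _ _ (ℤ.≤-refl , j≤j' , third-≤ q j≤j')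

  col-suc : ∀ j k → (j + 1ℤ) - (k + 1ℤ) ≡ j - k
  col-suc = solve-∀

  -- A point of `L` further along the column would force (i,j+1,k+1) into `L`.
  bounded-by-wall : ∀ {i j k j' k'} → Wall (i , j , k) → L (i , j' , k') → j' - k' ≡ j - k → j' ≤ j
  bounded-by-wall {i} {j} {k} {j'} {k'} (_ , ¬l) l q with j' ≤? j
  ... | yes p = p
  ... | no ¬p = ⊥-elim (¬l (L-along-column (trans (col-suc j k) (sym q))
          (subst (_≤ j') (ℤ.+-comm 1ℤ j) (ℤ.i<j⇒suc[i]≤j (ℤ.≰⇒> ¬p))) l))

  -- The point directly above the face is outside `L`, so in the column of the wall it must come
  -- after the wall's point, which is in `L`.
  wall-below-face : ∀ {i j k j' k'} → Wall (i , j , k) → Face (i - 1ℤ , j' , k') → j - k ≡ j' - k' → j < j'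
  wall-below-face {i} {j} {k} {j'} {k'} (l , _) (_ , ¬l) q with j' ≤? j
  ... | no ¬p = ℤ.≰⇒> ¬p
  ... | yes p = ⊥-elim (¬l (subst (λ z → L (z , j' , k')) (sym (sub-add i)) (L-along-column (sym q) p l)))

  -- The region swept between the rays from the two ends of `c` is bounded mod 2 by these rays and
  -- `c`. Exactly one end of `e` lies in it when `e` crosses this boundary an odd number of times.
  -- Adding the two values of `h c` to the crossings with the rays therefore leaves the crossing
  -- with `c`, and only `dual c` crosses `c`. The parity hypothesis puts the ends of `e` in the
  -- class opposite to those of `c`.
  incidence : ∀ c e → Valid c → Valid e → odd (ρ e - ρ c) ≡ true →
    (χ (proj₁ (ends c)) e xor χ (proj₂ (ends c)) e) xor
    (h c (proj₁ (ends e)) xor h c (proj₂ (ends e))) ≡ δ e (dual c)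
  incidence (short p) (short q) _ _ _ = refl
  -- The ends of `c` are one step apart in one column, so their rays differ in the single long
  -- diagonal with j' = j.
  incidence (short (i , j , k)) (long (i' , j' , k')) _ _ _ =
    trans (xor-identityʳ _)
      (trans (cong (λ x → A xor ((i' == i) ∧ x)) (cong₂ _∧_ (cong isZero (r₁ j k j' k')) refl))
        (∧-xor₂ (i' == i) (j' - k' == j - k)
          (trans (cong₂ _xor_ (cong pos (r₂ j j')) (cong pos (r₃ j j'))) (pos-step (j - j')))))
    where
    A = (i' == i) ∧ ((j' - k' == j - k) ∧ (j' <ᵇ 1ℤ + j))
    r₁ : ∀ j k j' k' → j' - k' - ((j - 1ℤ) - (k - 1ℤ)) ≡ j' - k' - (j - k)
    r₁ = solve-∀
    r₂ : ∀ j j' → 1ℤ + j - j' ≡ 1ℤ + (j - j')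
    r₂ = solve-∀
    r₃ : ∀ j j' → 1ℤ + (j - 1ℤ) - j' ≡ j - j'
    r₃ = solve-∀
  incidence (short (i , j , k)) (wall t b) _ _ _ =
    trans (xor-identityʳ _)
      (guard-xor (lvl (down b) == i) (cong pos (r j k (col b))))
    where
    r : ∀ j k y → y - (j - k) ≡ y - ((j - 1ℤ) - (k - 1ℤ))
    r = solve-∀
  incidence (long (i , j , k)) (short (i' , j' , k')) _ _ _ =
    trans (cong (λ x → A xor ((i' == i) ∧ x)) (cong₂ _∧_ (cong isZero (r₁ j k j' k')) refl))
      (∧-xor₂ (i' == i) (j' - k' == j - k)
        (trans (xor-comm (j' <ᵇ j) (j' - 1ℤ <ᵇ j))
          (trans (cong (_xor (j' <ᵇ j)) (cong pos (r₂ j j'))) (pos-step (j - j')))))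
    where
    A = (i' == i) ∧ ((j' - k' == j - k) ∧ (j' <ᵇ j))
    r₁ : ∀ j k j' k' → (j' - 1ℤ) - (k' - 1ℤ) - (j - k) ≡ j' - k' - (j - k)
    r₁ = solve-∀
    r₂ : ∀ j j' → j - (j' - 1ℤ) ≡ 1ℤ + (j - j')
    r₂ = solve-∀
  -- Each of the two rays meets `e` exactly when one particular end of `e` is swept, so the four
  -- terms cancel in pairs.
  incidence (long (i , j , k)) (long (i' , j' , k')) _ _ _ =
    trans (cong (_xor (A xor B)) (cong₂ _xor_
        (cong (g ∧_) (cong₂ _∧_ (cong isZero (r₁ j k j' k')) (cong pos (r₂ j j'))))
        (cong (g ∧_) (cong₂ _∧_ (cong isZero (r₃ j k j' k')) (cong pos (r₄ j j'))))))
      (xor-inner B A)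
    where
    g = i' == i
    A = g ∧ (((j' - 1ℤ) - k' == j - k) ∧ (j' - 1ℤ <ᵇ j))
    B = g ∧ ((j' - (k' - 1ℤ) == j - k) ∧ (j' <ᵇ j))
    r₁ : ∀ j k j' k' → j' - k' - ((j - 1ℤ) - k) ≡ j' - (k' - 1ℤ) - (j - k)
    r₁ = solve-∀
    r₂ : ∀ j j' → 1ℤ + (j - 1ℤ) - j' ≡ j - j'
    r₂ = solve-∀
    r₃ : ∀ j k j' k' → j' - k' - (j - (k - 1ℤ)) ≡ (j' - 1ℤ) - k' - (j - k)
    r₃ = solve-∀
    r₄ : ∀ j j' → 1ℤ + j - j' ≡ j - (j' - 1ℤ)
    r₄ = solve-∀
  incidence (long (i , j , k)) (wall (i' , jt , kt) (_ , jb , kb)) face (wt , wb , refl , adj) par =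
    trans (cong (χs xor_) (cong₂ _xor_ top bottom))
      (wall-row (i' - 1ℤ == i) ((j - 1ℤ) - k <ᵇ jb - kb) (j - (k - 1ℤ) <ᵇ jb - kb) (jb - kb == j - k) row)
    where
    χs = ((i' - 1ℤ == i) ∧ ((j - 1ℤ) - k <ᵇ jb - kb)) xor ((i' - 1ℤ == i) ∧ (j - (k - 1ℤ) <ᵇ jb - kb))
    -- The end `t` of the wall is never swept, being the last point of its column; the lower end
    -- `down b` is swept as soon as level and column agree.
    top : (i' == i) ∧ ((jt - kt == j - k) ∧ (jt <ᵇ j)) ≡ false
    top = ∧₃-false (i' == i) (jt - kt == j - k) λ p q r →
      ℤ.<⇒≱ (<ᵇ-sound jt j r)
        (bounded-by-wall wt (subst (λ z → L (z , j , k)) (sym (==-sound i' i p)) (proj₁ face)) (sym (==-sound (jt - kt) (j - k) q)))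
    bottom : (i' - 1ℤ == i) ∧ ((jb - kb == j - k) ∧ (jb <ᵇ j)) ≡ (i' - 1ℤ == i) ∧ (jb - kb == j - k)
    bottom = ∧₃-absorb (i' - 1ℤ == i) (jb - kb == j - k) λ p q →
      <⇒<ᵇ (wall-below-face wb (subst (λ z → Face (z , j , k)) (sym (==-sound (i' - 1ℤ) i p)) face) (==-sound (jb - kb) (j - k) q))
    r₁ : ∀ j k y → y - ((j - 1ℤ) - k) ≡ 1ℤ + (y - (j - k))
    r₁ = solve-∀
    r₂ : ∀ j k y → y - (j - (k - 1ℤ)) ≡ (y - (j - k)) - 1ℤ
    r₂ = solve-∀
    parity-clash : ∀ i i' y yt yb → odd (i' + yt - (i + (1ℤ + y))) ≡ true → i' - 1ℤ ≡ i →
      (yb ≡ 1ℤ + yt) ⊎ (yt ≡ 1ℤ + yb) → yb - y ≡ 1ℤ → ⊥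
    parity-clash i i' y yt yb o refl (inj₁ refl) q =
      ¬odd {i' + yt - (i' - 1ℤ + (1ℤ + y))} o 0ℤ (trans (e i' y yt) (cong (_- 1ℤ) q)) refl
      where
      e : ∀ i' y yt → i' + yt - (i' - 1ℤ + (1ℤ + y)) ≡ (1ℤ + yt - y) - 1ℤ
      e = solve-∀
    parity-clash i i' y yt yb o refl (inj₂ refl) q =
      ¬odd {i' + (1ℤ + yb) - (i' - 1ℤ + (1ℤ + y))} o (+ 2) (trans (e i' y yb) (cong (_+ 1ℤ) q)) refl
      where
      e : ∀ i' y yb → i' + (1ℤ + yb) - (i' - 1ℤ + (1ℤ + y)) ≡ (yb - y) + 1ℤ
      e = solve-∀
    row : (i' - 1ℤ == i) ≡ true →
      ((j - 1ℤ) - k <ᵇ jb - kb) xor (j - (k - 1ℤ) <ᵇ jb - kb) ≡ (jb - kb == j - k)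
    row p = trans (cong₂ _xor_ (cong pos (r₁ j k (jb - kb))) (cong pos (r₂ j k (jb - kb))))
      (pos-step₂ (jb - kb - (j - k))
        (parity-clash i i' (j - k) (jt - kt) (jb - kb) par (==-sound (i' - 1ℤ) i p) adj))
  incidence (wall (i , jt , kt) (_ , jb , kb)) (short (i' , j' , k')) _ _ _ =
    guard-xor (i' == i) (cong pos (r j' k' (jt - kt)))
    where
    r : ∀ j k y → j - k - y ≡ (j - 1ℤ) - (k - 1ℤ) - y
    r = solve-∀
  incidence (wall (i , jt , kt) (_ , jb , kb)) (long (i' , j' , k')) (wt , wb , refl , _) face par =
    trans (cong (_xor (g∧ l₁ xor g∧ l₂)) (trans (cong₂ _xor_ top bottom) (xor-identityʳ (g∧ (j' - k' == jt - kt)))))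
      (trans (cong ((g∧ (j' - k' == jt - kt)) xor_) (pair-row (i' == i) l₁ l₂ row))
        (xor-same (g∧ (j' - k' == jt - kt))))
    where
    g∧_ = λ x → (i' == i) ∧ x
    l₁ = jt - kt <ᵇ (j' - 1ℤ) - k'
    l₂ = jt - kt <ᵇ j' - (k' - 1ℤ)
    -- The test on `jco` is automatic for the ray from `t`, since the wall bounds the face, and
    -- fails for the ray from `down b`, since at that level the face lies beyond the wall.
    top : (i' == i) ∧ ((j' - k' == jt - kt) ∧ (j' <ᵇ 1ℤ + jt)) ≡ (i' == i) ∧ (j' - k' == jt - kt)
    top = ∧₃-absorb (i' == i) (j' - k' == jt - kt) λ p q → ≤⇒<ᵇ
      (bounded-by-wall wt (subst (λ z → L (z , j' , k')) (==-sound i' i p) (proj₁ face)) (==-sound (j' - k') (jt - kt) q))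
    bottom : (i' == i - 1ℤ) ∧ ((j' - k' == jb - kb) ∧ (j' <ᵇ 1ℤ + jb)) ≡ false
    bottom = ∧₃-false (i' == i - 1ℤ) (j' - k' == jb - kb) λ p q r →
      ℤ.<⇒≱ (<ᵇ-sound j' (1ℤ + jb) r) (ℤ.i<j⇒suc[i]≤j
        (wall-below-face wb (subst (λ z → Face (z , j' , k')) (==-sound i' (i - 1ℤ) p) face) (sym (==-sound (j' - k') (jb - kb) q))))
    r₁ : ∀ j k y → (j - 1ℤ) - k - y ≡ (j - k - y) - 1ℤ
    r₁ = solve-∀
    r₂ : ∀ j k y → j - (k - 1ℤ) - y ≡ 1ℤ + (j - k - y)
    r₂ = solve-∀
    parity-clash : ∀ i i' y y' → odd (i' + (1ℤ + y') - (i + y)) ≡ true → i' ≡ i → y' - y ≡ 1ℤ → ⊥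
    parity-clash i i' y y' o refl q = ¬odd {i' + (1ℤ + y') - (i + y)} o (+ 2) (trans (e i y y') (cong (λ z → 1ℤ + z) q)) refl
      where
      e : ∀ i y y' → i + (1ℤ + y') - (i + y) ≡ 1ℤ + (y' - y)
      e = solve-∀
    row : (i' == i) ≡ true →
      (jt - kt <ᵇ (j' - 1ℤ) - k') xor (jt - kt <ᵇ j' - (k' - 1ℤ)) ≡ (j' - k' == jt - kt)
    row p = trans (xor-comm l₁ l₂)
      (trans (cong₂ _xor_ (cong pos (r₂ j' k' (jt - kt))) (cong pos (r₁ j' k' (jt - kt))))
        (pos-step₂ (j' - k' - (jt - kt))
          (parity-clash i i' (jt - kt) (j' - k') par (==-sound i' i p))))
  incidence (wall (i , jt , kt) (_ , jb , kb)) (wall (i' , jt' , kt') (_ , jb' , kb')) (_ , _ , refl , adj) (_ , _ , refl , adj') par =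
    -- The ray from `t` meets `e` exactly when `down b'` is swept. These two terms cancel, and what
    -- remains concerns two walls of the same strip.
    trans (xor-cancel ((i' - 1ℤ == i) ∧ (jt - kt <ᵇ jb' - kb')) ((i' - 1ℤ == i - 1ℤ) ∧ (jb - kb <ᵇ jb' - kb')) ((i' == i) ∧ (jt - kt <ᵇ jt' - kt')))
      (trans (cong (λ x → (x ∧ (jb - kb <ᵇ jb' - kb')) xor ((i' == i) ∧ (jt - kt <ᵇ jt' - kt'))) (cong isZero (r₀ i i')))
        (pair-row (i' == i) (jb - kb <ᵇ jb' - kb') (jt - kt <ᵇ jt' - kt') λ p →
          row i i' (jt - kt) (jb - kb) (jt' - kt') (jb' - kb') par (==-sound i' i p) adj adj'))
    where
    xor-cancel : ∀ a b c → (a xor b) xor (c xor a) ≡ b xor c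
    xor-cancel false b c = cong (b xor_) (xor-identityʳ c)
    xor-cancel true false false = refl
    xor-cancel true false true = refl
    xor-cancel true true false = refl
    xor-cancel true true true = refl
    r₀ : ∀ i i' → i' - 1ℤ - (i - 1ℤ) ≡ i' - i
    r₀ = solve-∀
    suc-suc : ∀ y y' → 1ℤ + y' - (1ℤ + y) ≡ y' - y
    suc-suc = solve-∀
    left-suc : ∀ y y' → y' - (1ℤ + y) ≡ (y' - y) - 1ℤ
    left-suc = solve-∀
    right-suc : ∀ y y' → 1ℤ + y' - y ≡ 1ℤ + (y' - y)
    right-suc = solve-∀
    row : ∀ i i' yt yb yt' yb' → odd (i' + yt' - (i + yt)) ≡ true → i' ≡ i →
      (yb ≡ 1ℤ + yt) ⊎ (yt ≡ 1ℤ + yb) → (yb' ≡ 1ℤ + yt') ⊎ (yt' ≡ 1ℤ + yb') →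
      (yb <ᵇ yb') xor (yt <ᵇ yt') ≡ (yt' == yb) ∧ (yb' == yt)
    -- Walls whose columns change in the same direction move both thresholds alike, while a dual
    -- pair has opposite directions.
    row i _ yt _ yt' _ o refl (inj₁ refl) (inj₁ refl) = trans
      (trans (cong (_xor (yt <ᵇ yt')) (cong pos (suc-suc yt yt'))) (xor-same (yt <ᵇ yt')))
      (sym (trans (cong₂ _∧_ (cong isZero (left-suc yt yt')) (cong isZero (right-suc yt yt')))
        (isZero-clash (yt' - yt))))
    row i _ yt _ _ yb' o refl (inj₁ refl) (inj₂ refl) = trans
      (trans (xor-comm (1ℤ + yt <ᵇ yb') _)
        (trans (cong₂ _xor_ (cong pos (right-suc yt yb')) (cong pos (left-suc yt yb')))
          (pos-step₂ (yb' - yt) λ q →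
            ¬odd o (+ 2) (trans (e i yt yb') (cong (λ z → 1ℤ + z) q)) refl)))
      (sym (trans (cong (_∧ (yb' == yt)) (cong isZero (suc-suc yt yb'))) (∧-idem (yb' == yt))))
      where
      e : ∀ i y y' → i + (1ℤ + y') - (i + y) ≡ 1ℤ + (y' - y)
      e = solve-∀
    row i _ _ yb yt' _ o refl (inj₂ refl) (inj₁ refl) = trans
      (trans (cong₂ _xor_ (cong pos (right-suc yb yt')) (cong pos (left-suc yb yt')))
        (pos-step₂ (yt' - yb) λ q →
          ¬odd o 0ℤ (trans (e i yb yt') (cong (_- 1ℤ) q)) refl))
      (sym (trans (cong ((yt' == yb) ∧_) (cong isZero (suc-suc yb yt'))) (∧-idem (yt' == yb))))
      where
      e : ∀ i y y' → i + y' - (i + (1ℤ + y)) ≡ (y' - y) - 1ℤ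
      e = solve-∀
    row i _ _ yb _ yb' o refl (inj₂ refl) (inj₂ refl) = trans
      (trans (cong ((yb <ᵇ yb') xor_) (cong pos (suc-suc yb yb'))) (xor-same (yb <ᵇ yb')))
      (sym (trans (cong₂ _∧_ (cong isZero (right-suc yb yb')) (cong isZero (left-suc yb yb')))
        (trans (∧-comm (isZero (1ℤ + (yb' - yb))) _) (isZero-clash (yb' - yb)))))

  Pt-≡ : ∀ {p q} → lvl q ≡ lvl p → col q ≡ col p → jco q ≡ jco p → q ≡ p
  Pt-≡ {i , j , k} {_ , _ , k'} refl q refl =
    cong (λ z → i , j , z) (ℤ.≤-antisym (third-≤ {j} {k'} {j} {k} q ℤ.≤-refl) (third-≤ {j} {k} {j} {k'} (sym q) ℤ.≤-refl))

  same-column : ∀ {p q} → (lvl q == lvl p) ∧ ((col q == col p) ∧ (jco p == jco q)) ≡ true → q ≡ p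
  same-column {p} {q} t with ∧-true (lvl q == lvl p) _ t
  ... | t₁ , t' with ∧-true (col q == col p) _ t'
  ... | t₂ , t₃ = Pt-≡ (==-sound _ _ t₁) (==-sound (col q) (col p) t₂) (sym (==-sound _ _ t₃))

  -- Each of the two points is the last of `L` in the common column, so each bounds the other.
  wall-unique : ∀ {p q} → Wall p → Wall q → lvl q ≡ lvl p → col q ≡ col p → q ≡ p
  wall-unique wp wq refl e =
    Pt-≡ refl e (ℤ.≤-antisym (bounded-by-wall wp (proj₁ wq) e) (bounded-by-wall wq (proj₁ wp) (sym e)))

  δ-sound : ∀ e d → Valid e → Valid d → δ e d ≡ true → e ≡ d
  δ-sound (short q) (short p) _ _ t = cong short (same-column t)
  δ-sound (long q) (long p) _ _ t = cong long (same-column t)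
  δ-sound (wall t' b') (wall t b) (wt' , wb' , l' , _) (wt , wb , l , _) s
    with ∧-true (lvl t' == lvl t) _ s
  ... | s₁ , s' with ∧-true (col t' == col t) _ s'
  ... | s₂ , s₃ = cong₂ wall
    (wall-unique wt wt' lt (==-sound (col t') (col t) s₂))
    (wall-unique wb wb' (trans (sym l') (trans lt l)) (==-sound (col b') (col b) s₃))
    where
    lt = ==-sound (lvl t') (lvl t) s₁

  ≢⇒δ-false : ∀ e d → Valid e → Valid d → e ≢ d → δ e d ≡ false
  ≢⇒δ-false e d ve vd e≢d with δ e d in q
  ... | false = refl
  ... | true = ⊥-elim (e≢d (δ-sound e d ve vd q))

  parity-ends : ∀ d → Valid d →
    parity (proj₁ (ends d)) ≡ odd (ρ d) × parity (proj₂ (ends d)) ≡ odd (ρ d)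
  parity-ends (short (i , j , k)) _ = refl , cong odd (e i j k)
    where
    e : ∀ i j k → i + ((j - 1ℤ) - (k - 1ℤ)) ≡ i + (j - k)
    e = solve-∀
  parity-ends (long (i , j , k)) _ =
    trans (sym (odd-+2 (i + ((j - 1ℤ) - k)))) (cong odd (e₁ i j k)) , cong odd (e₂ i j k)
    where
    e₁ : ∀ i j k → 1ℤ + (1ℤ + (i + ((j - 1ℤ) - k))) ≡ i + (1ℤ + (j - k))
    e₁ = solve-∀
    e₂ : ∀ i j k → i + (j - (k - 1ℤ)) ≡ i + (1ℤ + (j - k))
    e₂ = solve-∀
  parity-ends (wall (i , jt , kt) (_ , jb , kb)) (_ , _ , refl , adj) = refl , bottom (jt - kt) (jb - kb) adj
    where
    bottom : ∀ yt yb → (yb ≡ 1ℤ + yt) ⊎ (yt ≡ 1ℤ + yb) → odd (i - 1ℤ + yb) ≡ odd (i + yt)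
    bottom yt _ (inj₁ refl) = cong odd (e i yt)
      where
      e : ∀ i y → i - 1ℤ + (1ℤ + y) ≡ i + y
      e = solve-∀
    bottom _ yb (inj₂ refl) = trans (sym (odd-+2 (i - 1ℤ + yb))) (cong odd (e i yb))
      where
      e : ∀ i y → 1ℤ + (1ℤ + (i - 1ℤ + y)) ≡ i + (1ℤ + y)
      e = solve-∀

  dual-valid : ∀ d → Valid d → Valid (dual d)
  dual-valid (short p) v = v
  dual-valid (long p) v = v
  dual-valid (wall t b) (wt , wb , l , inj₁ a) = wb , wt , sym l , inj₂ a
  dual-valid (wall t b) (wt , wb , l , inj₂ a) = wb , wt , sym l , inj₁ a

  dual-parity : ∀ d → Valid d → odd (ρ (dual d)) ≡ not (odd (ρ d))
  dual-parity (short (i , j , k)) _ = trans (cong odd (e i (j - k))) (odd-1+ (i + (j - k)))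
    where
    e : ∀ i y → i + (1ℤ + y) ≡ 1ℤ + (i + y)
    e = solve-∀
  dual-parity (long (i , j , k)) _ = trans (sym (odd-+2 (i + (j - k)))) (trans (cong odd (e i (j - k))) (odd-1+ (i + (1ℤ + (j - k)))))
    where
    e : ∀ i y → 1ℤ + (1ℤ + (i + y)) ≡ 1ℤ + (i + (1ℤ + y))
    e = solve-∀
  dual-parity (wall (i , jt , kt) (_ , jb , kb)) (_ , _ , refl , adj) = go (jt - kt) (jb - kb) adj
    where
    e : ∀ i y → i + (1ℤ + y) ≡ 1ℤ + (i + y)
    e = solve-∀
    go : ∀ yt yb → (yb ≡ 1ℤ + yt) ⊎ (yt ≡ 1ℤ + yb) → odd (i + yb) ≡ not (odd (i + yt))
    go yt _ (inj₁ refl) = trans (cong odd (e i yt)) (odd-1+ (i + yt))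
    go _ yb (inj₂ refl) = trans (sym (not-involutive _)) (cong not (sym (trans (cong odd (e i yb)) (odd-1+ (i + yb)))))

-- Edges of the grove as diagonals

module Grove (L : Subset) (ideal : IsOrderIdeal L) (inCone : InOriginCone L)
  (N : ℤ) (cutoff : IsCutoff (𝓘 L) N) (G : Graph) (grove : IsGrove (𝓘 L) N G) where

  open Surface L ideal
  open IsGrove grove

  I : Subset
  I = 𝓘 L

  -- All that the flux argument uses of an edge: its oriented form as a diagonal, and that the other
  -- diagonal of its rhombus has both ends on the surface but is missing from `G`.
  record Diagonal (u v : Pt) : Set where
    field
      diag    : Diag
      valid   : Valid diag
      same    : SameEdge (ends diag) u v
      present : HasEdge G (ends diag)
      absent  : ¬ HasEdge G (ends (dual diag))
      dual-I  : I (proj₁ (ends (dual diag))) × I (proj₂ (ends (dual diag)))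

  open Diagonal

  wall-at : ∀ {t} → I t → I (down t) → Wall t
  wall-at {i , j , k} (l , _) (_ , ¬l) =
    l , λ l' → ¬l (subst (λ z → L (z , j + 1ℤ , k + 1ℤ)) (sym (sub-add i)) l')

  face-at : ∀ {i j k} → I (i , j , k) → I (i , j - 1ℤ , k - 1ℤ) → Face (i , j , k)
  face-at {i} {j} {k} (l , _) (_ , ¬l) =
    l , λ l' → ¬l (subst₂ (λ y z → L (i + 1ℤ , y , z)) (sym (sub-add j)) (sym (sub-add k)) l')

  orient : ∀ {d u v} → SameEdge d u v → G u v → HasEdge G d
  orient (inj₁ (refl , refl)) g = g
  orient (inj₂ (refl , refl)) g = symmetric _ _ g

  wall-diagonal : ∀ {t b u v} → I t → I (down t) → I b → I (down b) → lvl t ≡ lvl b → Adjacent t b →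
    SameEdge (t , down b) u v → G u v → ¬ (G t (down b) × G b (down t)) → Diagonal u v
  wall-diagonal {t} {b} It Idt Ib Idb l adj s g ¬both = record
    { diag    = wall t b
    ; valid   = wall-at It Idt , wall-at Ib Idb , l , adj
    ; same    = s
    ; present = orient s g
    ; absent  = λ g' → ¬both (orient s g , g')
    ; dual-I  = Ib , Idt
    }

  diagonal : ∀ {u v} → G u v → Diagonal u v
  diagonal g with subgraph _ _ g
  ... | ta , p@(_ , _ , _) , rh@(Ip ∷ Ij ∷ Ik ∷ Ijk ∷ []) , inj₁ s = record
    { diag = long p ; valid = face-at Ip Ijk ; same = s ; present = orient s g
    ; absent = λ g' → notBoth ta p rh (orient s g , g') ; dual-I = Ip , Ijk }
  ... | ta , p@(_ , _ , _) , rh@(Ip ∷ Ij ∷ Ik ∷ Ijk ∷ []) , inj₂ s = record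
    { diag = short p ; valid = face-at Ip Ijk ; same = s ; present = orient s g
    ; absent = λ g' → notBoth ta p rh (g' , orient s g) ; dual-I = Ij , Ik }
  -- A long edge of r_b or r_c has `down p` as its lower end, so p takes the place of `b` and the
  -- edge is read backwards.
  ... | tb , p@(i , j , k) , rh@(Ip ∷ Ii ∷ Ik ∷ Iik ∷ []) , inj₁ s =
    wall-diagonal Ik Iik Ip Ii refl (inj₂ (col-third j k)) (SameEdge-swap s) g
      λ (g₁ , g₂) → notBoth tb p rh (symmetric _ _ g₁ , g₂)
  ... | tb , p@(i , j , k) , rh@(Ip ∷ Ii ∷ Ik ∷ Iik ∷ []) , inj₂ s =
    wall-diagonal Ip Ii Ik Iik refl (inj₁ (col-third j k)) s g
      λ (g₁ , g₂) → notBoth tb p rh (symmetric _ _ g₂ , g₁)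
  ... | tc , p@(i , j , k) , rh@(Ip ∷ Ii ∷ Ij ∷ Iij ∷ []) , inj₁ s =
    wall-diagonal Ij Iij Ip Ii refl (inj₁ (col-second j k)) (SameEdge-swap s) g
      λ (g₁ , g₂) → notBoth tc p rh (symmetric _ _ g₁ , g₂)
  ... | tc , p@(i , j , k) , rh@(Ip ∷ Ii ∷ Ij ∷ Iij ∷ []) , inj₂ s =
    wall-diagonal Ip Ii Ij Iij refl (inj₂ (col-second j k)) s g
      λ (g₁ , g₂) → notBoth tc p rh (symmetric _ _ g₂ , g₁)

  diag-parity : ∀ {u v} (D : Diagonal u v) → parity u ≡ odd (ρ (diag D)) × parity v ≡ odd (ρ (diag D))
  diag-parity D = SameEdge-all (λ x → parity x ≡ odd (ρ (diag D))) (same D) (parity-ends (diag D) (valid D))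

  parity-edge : ∀ {u v} → G u v → parity u ≡ parity v
  parity-edge g = trans (proj₁ (diag-parity (diagonal g))) (sym (proj₂ (diag-parity (diagonal g))))

  -- Mod 2 sums along a walk

  sum : (Diag → Bool) → ∀ {vs} → Linked G vs → Bool
  sum φ [] = false
  sum φ [-] = false
  sum φ (g ∷ lk) = φ (diag (diagonal g)) xor sum φ lk

  ∂ : (Pt → Bool) → Diag → Bool
  ∂ φ d = φ (proj₁ (ends d)) xor φ (proj₂ (ends d))

  ∂-edge : ∀ φ {u v} (D : Diagonal u v) → ∂ φ (diag D) ≡ φ u xor φ v
  ∂-edge φ D = SameEdge-xor φ (same D)

  telescope : ∀ φ x xs y (lk : Linked G ((x ∷ xs) ++ [ y ])) → sum (∂ φ) lk ≡ φ x xor φ y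
  telescope φ x [] y (g ∷ [-]) = trans (xor-identityʳ _) (∂-edge φ (diagonal g))
  telescope φ x (z ∷ xs) y (g ∷ lk) =
    trans (cong₂ _xor_ (∂-edge φ (diagonal g)) (telescope φ z xs y lk)) (xor-chain (φ x) (φ z) (φ y))

  sum-false : ∀ φ {vs} (lk : Linked G vs) → (∀ {u v} (D : Diagonal u v) → φ (diag D) ≡ false) → sum φ lk ≡ false
  sum-false φ [] _ = refl
  sum-false φ [-] _ = refl
  sum-false φ (g ∷ lk) p = cong₂ _xor_ (p (diagonal g)) (sum-false φ lk p)

  -- This is `incidence` summed over the walk. Edges of `G` preserve parity, so the hypothesis on
  -- the first vertex reaches every edge.
  sum-χ-balance : ∀ c → Valid c → ∀ {x xs} (lk : Linked G (x ∷ xs)) → parity x ≡ not (odd (ρ c)) →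
    (sum (χ (proj₁ (ends c))) lk xor sum (χ (proj₂ (ends c))) lk) xor sum (∂ (h c)) lk
      ≡ sum (λ e → δ e (dual c)) lk
  sum-χ-balance c vc [-] _ = refl
  sum-χ-balance c vc (g ∷ lk) p = trans
    (cong (_xor (∂h xor sum (∂ (h c)) lk)) (interchange χa (sum (χ a) lk) χb (sum (χ b) lk)))
    (trans (interchange (χa xor χb) (sum (χ a) lk xor sum (χ b) lk) ∂h (sum (∂ (h c)) lk))
      (cong₂ _xor_
        (incidence c e vc (valid D) (opposite⇒odd-difference (ρ e) (ρ c) (trans (sym (proj₁ (diag-parity D))) p)))
        (sum-χ-balance c vc lk (trans (sym (parity-edge g)) p))))
    where
    D = diagonal g
    e = diag D
    a = proj₁ (ends c)
    b = proj₂ (ends c)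
    χa = χ a e
    χb = χ b e
    ∂h = ∂ (h c) e

  -- Around a closed walk the contributions of `h c` telescope to zero.
  flux-difference : ∀ c → Valid c → ∀ v vs (lk : Linked G ((v ∷ vs) ++ [ v ])) → parity v ≡ not (odd (ρ c)) →
    sum (χ (proj₁ (ends c))) lk xor sum (χ (proj₂ (ends c))) lk ≡ sum (λ e → δ e (dual c)) lk
  flux-difference c vc v vs lk p =
    trans (sym (xor-identityʳ _))
      (trans (cong (F xor_) (sym (trans (telescope (h c) v vs v lk) (xor-same (h c v)))))
        (sum-χ-balance c vc lk p))
    where
    F = sum (χ (proj₁ (ends c))) lk xor sum (χ (proj₂ (ends c))) lk

  δ-refl : ∀ e → δ e e ≡ true
  δ-refl (short p) = cong₂ _∧_ (==-refl (lvl p)) (cong₂ _∧_ (==-refl (col p)) (==-refl (jco p)))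
  δ-refl (long p) = cong₂ _∧_ (==-refl (lvl p)) (cong₂ _∧_ (==-refl (col p)) (==-refl (jco p)))
  δ-refl (wall t b) = cong₂ _∧_ (==-refl (lvl t)) (cong₂ _∧_ (==-refl (col t)) (==-refl (col b)))

  dual-involutive : ∀ d → dual (dual d) ≡ d
  dual-involutive (short p) = refl
  dual-involutive (long p) = refl
  dual-involutive (wall t b) = refl

  δ-off : ∀ {u v} (D : Diagonal u v) e → Valid e → ∀ {x z} → SameEdge (ends e) x z →
    u ≢ x → v ≢ x → δ e (diag D) ≡ false
  δ-off D e ve s u≢x v≢x = ≢⇒δ-false e (diag D) ve (valid D) λ { refl →
    [ u≢x ∘ sym , v≢x ∘ sym ]′ (endpoints (same D) s) }

  -- An edge whose first vertex is neither `u` nor `v` is not the diagonal of `D`. The last vertex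
  -- `y` is left free because the cycle returns to its start.
  sum-δ-off : ∀ {u v} (D : Diagonal u v) x xs y (lk : Linked G ((x ∷ xs) ++ [ y ])) →
    All (u ≢_) (x ∷ xs) → All (v ≢_) (x ∷ xs) → sum (λ e → δ e (diag D)) lk ≡ false
  sum-δ-off D x [] y (g ∷ [-]) (u≢x ∷ _) (v≢x ∷ _) =
    cong (_xor false) (δ-off D _ (valid (diagonal g)) (same (diagonal g)) u≢x v≢x)
  sum-δ-off D x (z ∷ xs) y (g ∷ lk) (u≢x ∷ us) (v≢x ∷ vs) =
    cong₂ _xor_ (δ-off D _ (valid (diagonal g)) (same (diagonal g)) u≢x v≢x) (sum-δ-off D z xs y lk us vs)

  -- Descent to levels where the flux vanishes

  lowest : Diag → ℤ
  -- An arbitrary value: no ray meets a short diagonal.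
  lowest (short p) = 0ℤ
  lowest (long p) = lvl p
  lowest (wall t b) = lvl (down b)

  ==-above : ∀ {x y} → y < x → (x == y) ≡ false
  ==-above {x} {y} y<x with x == y in q
  ... | false = refl
  ... | true = ⊥-elim (ℤ.<-irrefl (sym (==-sound x y q)) y<x)

  χ-below : ∀ u e → lvl u < lowest e → χ u e ≡ false
  χ-below u (short p) _ = refl
  χ-below u (long p) l = cong (_∧ ((col p == col u) ∧ (jco p <ᵇ 1ℤ + jco u))) (==-above l)
  χ-below u (wall t b) l = cong (_∧ (col u <ᵇ col b)) (==-above l)

  -- A ray from `u` meets a diagonal only if the lower level of the latter is that of `u`, and a
  -- walk has finitely many edges.
  flux-below : ∀ {vs} (lk : Linked G vs) → ∃[ M ] (∀ u → lvl u < M → sum (χ u) lk ≡ false)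
  flux-below [] = 0ℤ , λ _ _ → refl
  flux-below [-] = 0ℤ , λ _ _ → refl
  flux-below (g ∷ lk) with flux-below lk
  ... | M , p = lowest e ⊓ M , λ u l → cong₂ _xor_
      (χ-below u e (ℤ.<-≤-trans l (ℤ.i⊓j≤i (lowest e) M)))
      (p u (ℤ.<-≤-trans l (ℤ.i⊓j≤j (lowest e) M)))
    where
    e = diag (diagonal g)

  -- Only the planes j = 0 and k = 0 occur: there the forced short edges lower `lvl`, whereas in the
  -- plane i = 0 they would keep it.
  data Far : Pt → Set where
    farB : ∀ {a c} → a ≤ 0ℤ → c ≤ 0ℤ → coordSum (a , 0ℤ , c) < - N → Far (a , 0ℤ , c)
    farC : ∀ {a b} → a ≤ 0ℤ → b ≤ 0ℤ → coordSum (a , b , 0ℤ) < - N → Far (a , b , 0ℤ)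

  coordSum-mono : ∀ {p q} → p ≤³ q → coordSum p ≤ coordSum q
  coordSum-mono (i , j , k) = ℤ.+-mono-≤ (ℤ.+-mono-≤ i j) k

  step-≤ : ∀ i → i - 1ℤ ≤ i
  step-≤ i = ℤ.i-j≤i i 1ℤ

  -- Clause (i) of the cutoff puts all four vertices into `I`, so they form a rhombus beyond radius
  -- N and `farShort` applies.
  forced : ∀ t p → coordSum p < - N → All (λ q → q ≤³ p × coordMax q ≡ 0ℤ) (rhombusVerts t p) →
    HasEdge G (shortEdge t p) × All (λ q → coordSum q < - N) (rhombusVerts t p)
  forced t p s qs = farShort t p (All.zipWith inI (below , qs)) below , below
    where
    below = All.map (λ {q} (q≤p , _) → ℤ.≤-<-trans (coordSum-mono {q} {p} q≤p) s) qs
    inI : ∀ {q} → coordSum q < - N × (q ≤³ p × coordMax q ≡ 0ℤ) → I q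
    inI (l , _ , m) = proj₁ cutoff _ (ℤ.<⇒≤ l) m

  ≤-pred : ∀ {i} → i ≤ 0ℤ → i - 1ℤ ≤ 0ℤ
  ≤-pred = ℤ.i≤j⇒i-k≤j 1ℤ

  far-step : ∀ {x} → Far x → ∃[ y ] (G x y × Far y × lvl y ≡ lvl x - 1ℤ)
  far-step (farB {a} {c} a≤0 c≤0 s) with forced tb _ s
      ( ((ℤ.≤-refl , ℤ.≤-refl , ℤ.≤-refl) , max a≤0 c≤0)
      ∷ ((step-≤ a , ℤ.≤-refl , ℤ.≤-refl) , max (≤-pred a≤0) c≤0)
      ∷ ((ℤ.≤-refl , ℤ.≤-refl , step-≤ c) , max a≤0 (≤-pred c≤0))
      ∷ ((step-≤ a , ℤ.≤-refl , step-≤ c) , max (≤-pred a≤0) (≤-pred c≤0)) ∷ [])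
    where
    max : ∀ {i k} → i ≤ 0ℤ → k ≤ 0ℤ → i ⊔ 0ℤ ⊔ k ≡ 0ℤ
    max {k = k} i≤0 k≤0 = trans (cong (_⊔ k) (ℤ.i≤j⇒i⊔j≡j i≤0)) (ℤ.i≥j⇒i⊔j≡i k≤0)
  ... | g , _ ∷ _ ∷ _ ∷ s' ∷ [] = _ , g , farB (≤-pred a≤0) (≤-pred c≤0) s' , refl
  far-step (farC {a} {b} a≤0 b≤0 s) with forced tc _ s
      ( ((ℤ.≤-refl , ℤ.≤-refl , ℤ.≤-refl) , max a≤0 b≤0)
      ∷ ((step-≤ a , ℤ.≤-refl , ℤ.≤-refl) , max (≤-pred a≤0) b≤0)
      ∷ ((ℤ.≤-refl , step-≤ b , ℤ.≤-refl) , max a≤0 (≤-pred b≤0))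
      ∷ ((step-≤ a , step-≤ b , ℤ.≤-refl) , max (≤-pred a≤0) (≤-pred b≤0)) ∷ [])
    where
    max : ∀ {i j} → i ≤ 0ℤ → j ≤ 0ℤ → i ⊔ j ⊔ 0ℤ ≡ 0ℤ
    max i≤0 j≤0 = ℤ.i≤j⇒i⊔j≡j (ℤ.⊔-lub i≤0 j≤0)
  ... | g , _ ∷ _ ∷ _ ∷ s' ∷ [] = _ , g , farC (≤-pred a≤0) (≤-pred b≤0) s' , refl

  lvl-far : ∀ {x} → Far x → lvl x ≤ 0ℤ
  lvl-far (farB a≤0 _ _) = a≤0
  lvl-far (farC a≤0 _ _) = a≤0

  descend : ∀ {x} → Far x → ∀ n → ∃[ y ] (Star G x y × Far y × lvl y ≤ - (+ n))
  descend f zero = _ , ε , f , lvl-far f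
  descend f (suc n) with descend f n
  ... | y , p , fy , l with far-step fy
  ... | z , g' , fz , e = z , p ◅◅ (g' ◅ ε) , fz ,
    subst₂ _≤_ (sym e) (shift (+ n)) (ℤ.+-monoˡ-≤ (- 1ℤ) l)
    where
    shift : ∀ m → - m - 1ℤ ≡ - (1ℤ + m)
    shift = solve-∀

  adjacent-I : ∀ {u v} → G u v → I v
  adjacent-I g with subgraph _ _ g
  ... | t , p , rh , s = vertex t p rh s
    where
    either : ∀ {a b u v} → SameEdge (a , b) u v → I a → I b → I v
    either s Ia Ib = proj₂ (SameEdge-all I s (Ia , Ib))
    vertex : ∀ t p → IsRhombus I t p → ∀ {u v} → SameEdge (longEdge t p) u v ⊎ SameEdge (shortEdge t p) u v → I v
    vertex ta p (i₁ ∷ i₂ ∷ i₃ ∷ i₄ ∷ []) (inj₁ s) = either s i₂ i₃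
    vertex ta p (i₁ ∷ i₂ ∷ i₃ ∷ i₄ ∷ []) (inj₂ s) = either s i₁ i₄
    vertex tb p (i₁ ∷ i₂ ∷ i₃ ∷ i₄ ∷ []) (inj₁ s) = either s i₂ i₃
    vertex tb p (i₁ ∷ i₂ ∷ i₃ ∷ i₄ ∷ []) (inj₂ s) = either s i₁ i₄
    vertex tc p (i₁ ∷ i₂ ∷ i₃ ∷ i₄ ∷ []) (inj₁ s) = either s i₂ i₃
    vertex tc p (i₁ ∷ i₂ ∷ i₃ ∷ i₄ ∷ []) (inj₂ s) = either s i₁ i₄

  connected-I : ∀ {u v} → Star G u v → I u → I v
  connected-I ε Iu = Iu
  connected-I (g ◅ p) _ = connected-I p (adjacent-I g)

  1-below : ∀ {x} → x ≤ - N - 1ℤ → x < - N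
  1-below l = ℤ.≤-<-trans l (ℤ.i≤pred[j]⇒i<j (ℤ.≤-reflexive (ℤ.+-comm (- N) (- 1ℤ))))

  range-below : ∀ {x} → InRange N x → x < - N
  range-below (inj₁ refl) = 1-below ℤ.≤-refl
  range-below (inj₂ refl) = 1-below (ℤ.+-monoʳ-≤ (- N) (-≤- ℕ.z≤n))

  -- Connection to `v` puts the point on the surface, and `inCone` then gives the signs of its
  -- coordinates.
  toB : ∀ {v a c} → Star G v (a , 0ℤ , c) → I v → a + c < - N → Far (a , 0ℤ , c)
  toB {a = a} {c} p Iv s with inCone _ (proj₁ (connected-I p Iv))
  ... | a≤0 , _ , c≤0 = farB a≤0 c≤0 (subst (_< - N) (cong (_+ c) (sym (ℤ.+-identityʳ a))) s)

  toC : ∀ {v a b} → Star G v (a , b , 0ℤ) → I v → a + b < - N → Far (a , b , 0ℤ)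
  toC {a = a} {b} p Iv s with inCone _ (proj₁ (connected-I p Iv))
  ... | a≤0 , b≤0 , _ = farC a≤0 b≤0 (subst (_< - N) (sym (ℤ.+-identityʳ (a + b))) s)

  -- Each of the prescribed sets has a point in the plane j = 0 or k = 0, and its validity condition
  -- keeps the coordinate sum below -N.
  far-in-label : ∀ ℓ → ValidLabel N ℓ → ∀ {v} → I v → ComponentContains G v (labelSet ℓ) →
    ∃[ x ] (Star G v x × Far x)
  far-in-label (pairA p q) (_ , _ , r) Iv (_ ∷ c ∷ []) = _ , c , toB c Iv (range-below r)
  far-in-label (pairB p q) (_ , _ , r) Iv (c ∷ _ ∷ []) = _ , c , toC c Iv (range-below r)
  far-in-label (pairC p q) (_ , _ , r) Iv (c ∷ _ ∷ []) =
    _ , c , toB c Iv (subst (_< - N) (ℤ.+-comm p q) (range-below r))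
  far-in-label (triple p) r Iv (_ ∷ c ∷ _ ∷ []) = _ , c , toB c Iv (range-below r)
  far-in-label (singleA q) r Iv (c ∷ []) =
    _ , c , toB c Iv (subst (_< - N) (sym (ℤ.+-identityˡ q)) (1-below r))
  far-in-label (singleB q) r Iv (c ∷ []) =
    _ , c , toC c Iv (subst (_< - N) (sym (ℤ.+-identityˡ q)) (1-below r))
  far-in-label (singleC q) r Iv (c ∷ []) =
    _ , c , toB c Iv (subst (_< - N) (sym (ℤ.+-identityʳ q)) (1-below r))

  -- The flux of a closed walk

  module _ v vs (lk : Linked G ((v ∷ vs) ++ [ v ])) where

    flux : Pt → Bool
    flux u = sum (χ u) lk

    -- The flux could change only if the walk used the diagonal crossing this edge, but `G` holds
    -- one diagonal of each rhombus.
    flux-edge : ∀ {u w} → G u w → parity u ≡ not (parity v) → flux u ≡ flux w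
    flux-edge {u} {w} g p = xor-false⇒≡ (flux u) (flux w) (begin
      flux u xor flux w                                       ≡⟨ SameEdge-xor flux (same D) ⟨
      flux (proj₁ (ends c)) xor flux (proj₂ (ends c))         ≡⟨ flux-difference c (valid D) v vs lk opposite ⟩
      sum (λ e → δ e (dual c)) lk                             ≡⟨ sum-false _ lk (λ E → ≢⇒δ-false _ _ (valid E) (dual-valid c (valid D))
                                                                   λ q → absent D (subst (HasEdge G ∘ ends) q (present E))) ⟩
      false                                                   ∎)
      where
      open ≡-Reasoning
      D = diagonal g
      c = diag D
      opposite : parity v ≡ not (odd (ρ c))
      opposite = trans (sym (not-involutive _)) (cong not (trans (sym p) (proj₁ (diag-parity D))))

    flux-connected : ∀ {u w} → Star G u w → parity u ≡ not (parity v) → flux u ≡ flux w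
    flux-connected ε _ = refl
    flux-connected (g ◅ p) q = trans (flux-edge g q) (flux-connected p (trans (sym (parity-edge g)) q))

    flux-zero : ∀ u → I u → parity u ≡ not (parity v) → flux u ≡ false
    flux-zero u Iu p with compHasSet u Iu | flux-below lk
    ... | ℓ , vℓ , c | M , zero-below with far-in-label ℓ vℓ Iu c
    -- The number of steps is chosen to end strictly below `M`, also for negative `M`.
    ... | x , u⇝x , far with descend far (suc ∣ M ∣)
    ... | y , x⇝y , _ , l = trans (flux-connected (u⇝x ◅◅ x⇝y) p) (zero-below y (ℤ.≤-<-trans l (-∣M∣-1<M M)))
      where
      -∣M∣-1<M : ∀ M → - (+ suc ∣ M ∣) < M
      -∣M∣-1<M (+ n) = -<+
      -∣M∣-1<M -[1+ n ] = -<- (ℕ.n<1+n n)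

  acyclic : Acyclic G
  acyclic (v , [] , ℕ.s≤s () , _)
  acyclic (v , _ ∷ [] , ℕ.s≤s (ℕ.s≤s ()) , _)
  acyclic (v , w ∷ z ∷ zs , _ , ((v≢w ∷ v≢zs) ∷ w≢zs ∷ _) , lk@(g ∷ g' ∷ lk')) = absurd (begin
    true                                              ≡⟨ cong₂ _xor_ (δ-refl e) rest ⟨
    sum (λ d → δ d e) lk                              ≡⟨ cong (λ e' → sum (λ d → δ d e') lk) (dual-involutive e) ⟨
    sum (λ d → δ d (dual (dual e))) lk                ≡⟨ flux-difference c (dual-valid e (valid D)) v (w ∷ z ∷ zs) lk opposite ⟨
    F (proj₁ (ends c)) xor F (proj₂ (ends c))         ≡⟨ cong₂ _xor_ (zero-at (proj₁ (dual-I D)) (proj₁ parities)) (zero-at (proj₂ (dual-I D)) (proj₂ parities)) ⟩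
    false                                             ∎)
    where
    open ≡-Reasoning
    absurd : true ≡ false → ⊥
    absurd ()
    D = diagonal g
    e = diag D
    -- The diagonal crossing the first edge of the cycle. Its ends lie on the surface in the class
    -- opposite to `v`, so `flux-zero` holds at both.
    c = dual e
    F = flux v (w ∷ z ∷ zs) lk
    rest : sum (λ d → δ d e) (g' ∷ lk') ≡ false
    -- The second edge starts at the end `w` of `e`, so it is told apart by its other end `z`. This
    -- is where a cycle needs three vertices.
    rest = cong₂ _xor_
      (δ-off D _ (valid (diagonal g')) (SameEdge-sym (same (diagonal g'))) (All.head v≢zs) (All.head w≢zs))
      (sum-δ-off D z zs v lk' v≢zs w≢zs)
    parities = parity-ends c (dual-valid e (valid D))
    opposite' : odd (ρ c) ≡ not (parity v)
    opposite' = trans (dual-parity e (valid D)) (cong not (sym (proj₁ (diag-parity D))))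
    opposite : parity v ≡ not (odd (ρ c))
    opposite = trans (sym (not-involutive _)) (cong not (sym opposite'))
    zero-at : ∀ {u} → I u → parity u ≡ odd (ρ c) → F u ≡ false
    zero-at {u} Iu p = flux-zero v (w ∷ z ∷ zs) lk u Iu (trans p opposite')

theorem2 : (L : Subset) → IsOrderIdeal L → InOriginCone L → UCapConeFinite L →
    (N : ℤ) → IsCutoff (𝓘 L) N →
    (G : Graph) → IsGrove (𝓘 L) N G → Acyclic G
theorem2 L ideal inCone _ N cutoff G grove = Grove.acyclic L ideal inCone N cutoff G grove
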